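{- Let $f(x_1,\ldots,x_n)$ and $h(x_1,\ldots,x_n)$ be arbitrary Boolean functions of $n$ variables represented in conjunctive normal form with $m$ clauses, such that there are Boolean assignment tuples $(\sigma_1,\ldots,\sigma_n)$ and $(\delta_1,\ldots,\delta_n)$ in $\{0,1\}^n$ with $f(\sigma_1,\ldots,\sigma_n)=1$ and $h(\delta_1,\ldots,\delta_n)=1$. Then the function $h(x_1,\ldots,x_n)$ is generated by the function $f(x_1,\ldots,x_n)$ as a result of extended admissible changes, and also the function $f(x_1,\ldots,x_n)$ is generated by the function $h(x_1,\ldots,x_n)$ as a result of extended admissible changes.
   Context: CNF conventions. A Boolean function $f(x_1,\ldots,x_n)$ in conjunctive normal form (CNF) with $m$ clauses is given as $f=\bigwedge_{i=1}^m c_i$, each clause being $c_i=x_{j_1}^{\alpha_1}\vee\cdots\vee x_{j_k}^{\alpha_k}$ with $k\in\{1,\ldots,n\}$, $\{j_1,\ldots,j_k\}\subseteq\{1,\ldots,n\}$, $\alpha_r\in\{0,1\}$, $x_j^0=\bar x_j$, $x_j^1=x_j$. Standing assumptions: no clause contains both a variable and its negation; every variable $x_j$, $j\in\{1,\ldots,n\}$, occurs (negated or not) in some clause. Clauses are numbered and identified with their numbers, so $S(f)=\{c_1,\ldots,c_m\}$ is an ordered set of $m$ elements. Special decomposition and covering. For a nonempty ordered set $S=\{e_1,\ldots,e_m\}$, an ordered set $d_nS=\{(M_1^0,M_1^1),\ldots,(M_n^0,M_n^1)\}$ of ordered pairs of subsets of $S$ is a special decomposition of $S$ if for all $i$, $M_i^0\cap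 M_i^1=\emptyset$ and ($M_i^0\ne\emptyset$ or $M_i^1\neq\emptyset$), and $\bigcup_{i}(M_i^0\cup M_i^1)=S$. The ordered set $c_nS=\{M_1^{\alpha_1},\ldots,M_n^{\alpha_n}\}$ is a special covering for $S$ under $d_nS$ if $\bigcup_i M_i^{\alpha_i}=S$. Decomposition generated by $f$. $d_nS(f)=\{(F_1^0,F_1^1),\ldots,(F_n^0,F_n^1)\}$, where $F_i^\alpha$ is the set of clauses $c_j\in S(f)$ containing the literal $x_i^\alpha$. When $f(\sigma_1,\ldots,\sigma_n)=1$, $\{F_1^{\sigma_1},\ldots,F_n^{\sigma_n}\}$ is the associated special covering $c_nS(f)$. Function generated by a special decomposition $d_nS$. $h=\bigwedge_{i=1}^m c_i'$, where $c_i'$ is the disjunction of the literals in $\{x_j^\alpha: e_i\in M_j^\alpha,\ j\in\{1,\ldots,n\},\ \alpha\in\{0,1\}\}$ (the first component of the $j$-th pair playing the role of $M_j^0$, the second that of $M_j^1$). Admissible changes under a tuple $(\alpha_1,\ldots,\alpha_n)$. Let $c_nS=\{M_1^{\alpha_1},\ldots,M_n^{\alpha_n}\}$ be a special covering under $d_nS$. Write $\bar\delta=1-\delta$; membership of $M_i^\delta$ in $c_nS$ means $\delta=\alpha_i$. The following changes are admissible: (i.1) for $e\in M_i^\delta$, replace $M_i^\delta$ by $M_i^\delta\setminus\{e\}$, if $M_i^\delta\notin c_nS$ and $(M_i^\delta\setminus\{e\})\cup M_i^{\bar\delta}\neq\emptyset$; (i.2) for $e\in S$ with $e\notin M_i^0\cup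 M_i^1$, replace $M_i^\delta$ by $M_i^\delta\cup\{e\}$; (i.3) if $M_j^\gamma$ and $M_i^\delta$ are both in $c_nS$, then for $e$ with $e\in M_j^\gamma$ and $e\notin M_i^{\bar\delta}$, replace $M_j^\gamma$ by $M_j^\gamma\setminus\{e\}$ and $M_i^\delta$ by $M_i^\delta\cup\{e\}$. Changes are applied successively, each to the current pairs and with the current covering sets having the current tuple of superscripts. Extended admissible changes. To the admissible changes one adds the operation of permuting the components of an ordered pair, i.e. replacing $(M_i^0,M_i^1)$ by $(M_i^1,M_i^0)$ (the former $M_i^1$ becomes the first component, the former $M_i^0$ the second). If admissible changes are being performed under a tuple of superscripts $(\sigma_1,\ldots,\sigma_n)$ and the components of the $i$-th pair are permuted, then admissible changes continue under the tuple $(\sigma_1,\ldots,1-\sigma_i,\ldots,\sigma_n)$. The starting tuple is that of a special covering under the starting decomposition. Generation by extended admissible changes. For $f$ such that $f(\sigma_1,\ldots,\sigma_n)=1$ for some assignment tuple, $h$ is generated by $f$ as a result of extended admissible changes if a special decomposition is generated as a result of extended admissible changes in $d_nS(f)$ and $h$ is the function generated by that special decomposition. -}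

module Defs where

open import Data.Bool.Base using (Bool; true; false; not; _∧_; _∨_)
open import Data.Bool.ListAction using (any; all)
open import Data.Fin.Base using (Fin)
open import Data.Fin.Subset using (Subset; _∈_; _∉_; _∩_; _∪_; _-_; ⁅_⁆; Empty; Nonempty)
open import Data.List.Base using (allFin)
open import Data.Nat.Base using (ℕ)
open import Data.Product.Base using (∃-syntax; _×_; _,_; proj₁; proj₂; swap)
open import Data.Sum.Base using (_⊎_)
open import Data.Vec.Base using (Vec; lookup; tabulate; updateAt)
open import Relation.Binary.Construct.Closure.ReflexiveTransitive using (Star)
open import Relation.Binary.PropositionalEquality.Core using (_≡_)
open import Relation.Nullary.Negation.Core using (¬_)

private
  variable
    k l m n : ℕ

-- Superscripts 0 and 1 are the booleans false and true; a tuple of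
-- superscripts is also an assignment of truth values.
Tuple : ℕ → Set
Tuple n = Vec Bool n

-- Ordered pairs (P⁰ , P¹) of subsets of a k-element set, with P ⟨ α ⟩ = P^α.
Pair : ℕ → Set
Pair k = Subset k × Subset k

infix 8 _⟨_⟩

_⟨_⟩ : Pair k → Bool → Subset k
P ⟨ false ⟩ = proj₁ P
P ⟨ true  ⟩ = proj₂ P

modify : Bool → (Subset k → Subset k) → Pair k → Pair k
modify false f (P⁰ , P¹) = f P⁰ , P¹
modify true  f (P⁰ , P¹) = P⁰ , f P¹

-- The pairs (Qⱼ⁰ , Qⱼ¹) with i ∈ Qⱼ^α exactly when j ∈ Pᵢ^α.
transposePairs : Vec (Pair k) l → Vec (Pair l) k
transposePairs Ps = tabulate λ j → at j false , at j true
  where at = λ j α → tabulate λ i → lookup (lookup Ps i ⟨ α ⟩) j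

-- A clause is the set of its literals: c ⟨ α ⟩ holds the indices i for which
-- the literal xᵢ^α (xᵢ¹ = xᵢ, xᵢ⁰ = ¬ xᵢ) occurs in c.
Clause : ℕ → Set
Clause = Pair

-- Clauses are identified with their numbers, so two differently numbered
-- clauses may contain the same literals.
record CNF (n m : ℕ) : Set where
  field
    clauses    : Vec (Clause n) m
    nonempty   : ∀ j → ∃[ i ] ∃[ α ] i ∈ lookup clauses j ⟨ α ⟩
    consistent : ∀ j i → ¬ (i ∈ lookup clauses j ⟨ false ⟩ × i ∈ lookup clauses j ⟨ true ⟩)
    occurs     : ∀ i → ∃[ j ] ∃[ α ] i ∈ lookup clauses j ⟨ α ⟩

open CNF public

evalLiteral : Tuple n → Fin n → Bool → Bool
evalLiteral σ i true  = lookup σ i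
evalLiteral σ i false = not (lookup σ i)

evalClause : Clause n → Tuple n → Bool
evalClause {n} c σ = any (λ i → literalIn i false ∨ literalIn i true) (allFin n)
  where literalIn = λ i α → lookup (c ⟨ α ⟩) i ∧ evalLiteral σ i α

eval : CNF n m → Tuple n → Bool
eval {m = m} f σ = all (λ j → evalClause (lookup (clauses f) j) σ) (allFin m)

-- The ordered set S has the elements Fin m.
Decomposition : ℕ → ℕ → Set
Decomposition n m = Vec (Pair m) n

component : Decomposition n m → Fin n → Bool → Subset m
component d i α = lookup d i ⟨ α ⟩

record IsSpecialDecomposition (d : Decomposition n m) : Set where
  field
    disjoint  : ∀ i → Empty (component d i false ∩ component d i true)
    inhabited : ∀ i → Nonempty (component d i false) ⊎ Nonempty (component d i true)
    covers    : ∀ e → ∃[ i ] e ∈ component d i false ∪ component d i true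

IsSpecialCovering : Decomposition n m → Tuple n → Set
IsSpecialCovering d α = ∀ e → ∃[ i ] e ∈ component d i (lookup α i)

decompositionOf : CNF n m → Decomposition n m
decompositionOf f = transposePairs (clauses f)

-- Clause number e is the set of literals xⱼ^α with e ∈ Mⱼ^α.
generatedClauses : Decomposition n m → Vec (Clause n) m
generatedClauses = transposePairs

-- Mᵢ^δ belongs to the covering with superscripts α.
InCovering : Tuple n → Fin n → Bool → Set
InCovering α i δ = δ ≡ lookup α i

delete insert : Fin n → Bool → Fin m → Decomposition n m → Decomposition n m
delete i δ e d = updateAt d i (modify δ (_- e))
insert i δ e d = updateAt d i (modify δ (_∪ ⁅ e ⁆))

data AdmissibleChange (α : Tuple n) (d : Decomposition n m) : Decomposition n m → Set where
  remove : ∀ i δ e →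
           e ∈ component d i δ →
           ¬ InCovering α i δ →
           Nonempty ((component d i δ - e) ∪ component d i (not δ)) →
           AdmissibleChange α d (delete i δ e d)
  add    : ∀ i δ e →
           e ∉ component d i false ∪ component d i true →
           AdmissibleChange α d (insert i δ e d)
  move   : ∀ j γ i δ e →
           InCovering α j γ →
           InCovering α i δ →
           e ∈ component d j γ →
           e ∉ component d i (not δ) →
           AdmissibleChange α d (insert i δ e (delete j γ e d))

State : ℕ → ℕ → Set
State n m = Decomposition n m × Tuple n

-- Admissible changes are defined only for a special covering under a special
-- decomposition. This is a real restriction on sequences of changes: move may
-- leave a pair with both components empty, and admissible changes cannot be
-- applied to such a result.
data ExtendedChange : State n m → State n m → Set where
  change  : ∀ {α : Tuple n} {d d′ : Decomposition n m} →
            IsSpecialDecomposition d →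
            IsSpecialCovering d α →
            AdmissibleChange α d d′ →
            ExtendedChange (d , α) (d′ , α)
  permute : ∀ {α : Tuple n} {d : Decomposition n m} i →
            ExtendedChange (d , α) (updateAt d i swap , updateAt α i not)

-- h is generated by f by extended admissible changes that start from the
-- special covering associated with the assignment σ.
record GeneratedFrom (f : CNF n m) (σ : Tuple n) (h : CNF n m) : Set where
  field
    startCovering : IsSpecialCovering (decompositionOf f) σ
    final         : Decomposition n m
    finalTuple    : Tuple n
    changes       : Star ExtendedChange (decompositionOf f , σ) (final , finalTuple)
    finalSpecial  : IsSpecialDecomposition final
    generates     : clauses h ≡ generatedClauses final

{-# OPTIONS --safe #-}

-- Inserting an element of S into a pair that avoids it is reversible: an
-- insertion into the noncovering component is undone by a removal, one into the
-- covering component by moving the element to a pair that already covers it.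
-- For m ≥ 2 every special decomposition with covering α is thereby connected to
-- the saturated one, in which Mᵢ^αᵢ = S for all i: before an element is taken
-- out of a noncovering component, a second one is inserted into its pair, so
-- that the pair never becomes empty. Saturated decompositions are related by
-- permutations of components. For m = 1 all special decompositions are
-- saturated, though perhaps under a tuple other than the given one, and
-- permutations suffice.
module Submission where

open import Defs
open import Data.Bool.Base using (Bool; true; false; not; T; _∧_)
open import Data.Bool.Properties using (T-≡; T-∧; T-∨; not-¬; ¬-not)
  renaming (_≟_ to _≟ᵇ_)
open import Data.Empty using (⊥-elim)
open import Data.Fin.Base using (Fin; zero; suc)
open import Data.Fin.Properties using () renaming (_≟_ to _≟ᶠ_)
open import Data.Fin.Subset using (Nonempty; _∈_; _∉_; _⊆_; _∪_; _-_; ⊤; ⊥)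
open import Data.Fin.Subset.Properties
  using (_∈?_; ⊆-antisym; ∈⊤; ∉⊥; x∈⁅x⁆; x∈⁅y⁆⇒x≡y; x∈p∪q⁺; x∈p∪q⁻; x∈p∩q⁻;
         x∈p∧x≢y⇒x∈p-y; p─q⊆p)
open import Data.List.Base using ([]; _∷_; allFin; cartesianProduct)
open import Data.List.Membership.Propositional.Properties
  using (∈-allFin; ∈-cartesianProduct⁺)
open import Data.List.Relation.Unary.All as All using (All; []; _∷_)
open import Data.List.Relation.Unary.All.Properties using (all⁺)
open import Data.List.Relation.Unary.Any using (satisfied)
open import Data.List.Relation.Unary.Any.Properties using (any⁻)
open import Data.Nat.Base using (ℕ; suc; NonZero)
open import Data.Product.Base using (∃-syntax; ∃₂; _×_; _,_; proj₁; proj₂; swap)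
open import Data.Product.Properties using (≡-dec)
open import Data.Sum.Base using (_⊎_; inj₁; inj₂; [_,_]′)
open import Data.Vec.Base using (Vec; []; _∷_; there; lookup; tabulate; map; updateAt)
open import Data.Vec.Properties
  using (lookup∘tabulate; tabulate∘lookup; tabulate-cong; lookup-map;
         lookup∘updateAt; lookup∘updateAt′; []=⇒lookup; lookup⇒[]=)
open import Function.Base using (_∘_; case_of_)
open import Function.Bundles using (Equivalence)
open import Relation.Binary.Construct.Closure.ReflexiveTransitive as Star
  using (Star; ε; _◅_; _◅◅_; gmap)
open import Relation.Binary.PropositionalEquality.Core
  using (_≡_; _≢_; refl; sym; trans; cong; cong₂; subst)
open import Relation.Nullary using (Dec; yes; no)

private
  variable
    k l m n : ℕ
    A : Set

lookup-injective : {xs ys : Vec A n} → (∀ i → lookup xs i ≡ lookup ys i) → xs ≡ ys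
lookup-injective {xs = xs} {ys} eq =
  trans (sym (tabulate∘lookup xs)) (trans (tabulate-cong eq) (tabulate∘lookup ys))

x∉p-x : ∀ (x : Fin n) p → x ∉ p - x
x∉p-x zero    (_ ∷ _) ()
x∉p-x (suc x) (_ ∷ p) (there x∈p-x) = x∉p-x x p x∈p-x

_⊑_ : Decomposition n m → Decomposition n m → Set
d ⊑ d′ = ∀ i α → component d i α ⊆ component d′ i α

-- Equations between decompositions are proved through this lemma, so that it suffices to follow
-- single memberships through insertions and deletions.
⊑-antisym : {d d′ : Decomposition n m} → d ⊑ d′ → d′ ⊑ d → d ≡ d′
⊑-antisym d⊑d′ d′⊑d = lookup-injective λ i →
  cong₂ _,_ (⊆-antisym (d⊑d′ i false) (d′⊑d i false))
            (⊆-antisym (d⊑d′ i true) (d′⊑d i true))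

-- Insertion and deletion

modify-≡ : ∀ δ {g} (P : Pair k) → modify δ g P ⟨ δ ⟩ ≡ g (P ⟨ δ ⟩)
modify-≡ false P = refl
modify-≡ true  P = refl

modify-≢ : ∀ {γ δ} {g} (P : Pair k) → γ ≢ δ → modify δ g P ⟨ γ ⟩ ≡ P ⟨ γ ⟩
modify-≢ {γ = false} {false} P γ≢δ = ⊥-elim (γ≢δ refl)
modify-≢ {γ = false} {true}  P γ≢δ = refl
modify-≢ {γ = true}  {false} P γ≢δ = refl
modify-≢ {γ = true}  {true}  P γ≢δ = ⊥-elim (γ≢δ refl)

component-modify-≡ : ∀ (d : Decomposition n m) i δ {g} →
                     component (updateAt d i (modify δ g)) i δ ≡ g (component d i δ)
component-modify-≡ d i δ =
  trans (cong (_⟨ δ ⟩) (lookup∘updateAt i d)) (modify-≡ δ (lookup d i))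

component-modify-≢ : ∀ (d : Decomposition n m) {i δ k γ} {g} → (k , γ) ≢ (i , δ) →
                     component (updateAt d i (modify δ g)) k γ ≡ component d k γ
component-modify-≢ d {i} {δ} {k} {γ} ≢ with k ≟ᶠ i
... | yes refl = trans (cong (_⟨ γ ⟩) (lookup∘updateAt i d))
                       (modify-≢ (lookup d i) (≢ ∘ cong (i ,_)))
... | no k≢i   = cong (_⟨ γ ⟩) (lookup∘updateAt′ k i k≢i d)

_≟ᶜ_ : (c c′ : Fin n × Bool) → Dec (c ≡ c′)
_≟ᶜ_ = ≡-dec _≟ᶠ_ _≟ᵇ_

-- A triple `(k , γ , f)` encodes the incidence of `f` with component `γ` of pair `k`. An insertion
-- or deletion affects exactly one triple, and one match on `refl` identifies all three coordinates.
_≟ˡ_ : (c c′ : Fin n × Bool × Fin m) → Dec (c ≡ c′)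
_≟ˡ_ = ≡-dec _≟ᶠ_ (≡-dec _≟ᵇ_ _≟ᶠ_)

module _ (d : Decomposition n m) (i : Fin n) (δ : Bool) (e : Fin m) where

  ∈-insert-new : e ∈ component (insert i δ e d) i δ
  ∈-insert-new = subst (e ∈_) (sym (component-modify-≡ d i δ)) (x∈p∪q⁺ (inj₂ (x∈⁅x⁆ e)))

  ∈-insert-old : d ⊑ insert i δ e d
  ∈-insert-old k γ {f} f∈ with (k , γ) ≟ᶜ (i , δ)
  ... | yes refl = subst (f ∈_) (sym (component-modify-≡ d i δ)) (x∈p∪q⁺ (inj₁ f∈))
  ... | no ≢     = subst (f ∈_) (sym (component-modify-≢ d ≢)) f∈

  ∈-insert⁻ : ∀ k γ {f} → f ∈ component (insert i δ e d) k γ →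
              f ∈ component d k γ ⊎ (k , γ , f) ≡ (i , δ , e)
  ∈-insert⁻ k γ {f} f∈ with (k , γ) ≟ᶜ (i , δ)
  ... | no ≢     = inj₁ (subst (f ∈_) (component-modify-≢ d ≢) f∈)
  ... | yes refl with x∈p∪q⁻ _ _ (subst (f ∈_) (component-modify-≡ d i δ) f∈)
  ...   | inj₁ f∈d = inj₁ f∈d
  ...   | inj₂ f∈e with refl ← x∈⁅y⁆⇒x≡y e f∈e = inj₂ refl

  ∈-delete⁺ : ∀ k γ {f} → f ∈ component d k γ → (k , γ , f) ≢ (i , δ , e) →
              f ∈ component (delete i δ e d) k γ
  ∈-delete⁺ k γ {f} f∈ f≢ with (k , γ) ≟ᶜ (i , δ)
  ... | yes refl = subst (f ∈_) (sym (component-modify-≡ d i δ))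
                         (x∈p∧x≢y⇒x∈p-y f∈ λ { refl → f≢ refl })
  ... | no ≢     = subst (f ∈_) (sym (component-modify-≢ d ≢)) f∈

  ∈-delete-old : delete i δ e d ⊑ d
  ∈-delete-old k γ {f} f∈ with (k , γ) ≟ᶜ (i , δ)
  ... | yes refl = p─q⊆p _ _ (subst (f ∈_) (component-modify-≡ d i δ) f∈)
  ... | no ≢     = subst (f ∈_) (component-modify-≢ d ≢) f∈

  ∉-delete : e ∉ component (delete i δ e d) i δ
  ∉-delete e∈ = x∉p-x e _ (subst (e ∈_) (component-modify-≡ d i δ) e∈)

module _ (d : Decomposition n m) (i : Fin n) (δ : Bool) (e : Fin m) where

  insert-present : e ∈ component d i δ → insert i δ e d ≡ d
  insert-present e∈ = ⊑-antisym
    (λ k γ f∈ → case ∈-insert⁻ d i δ e k γ f∈ of λ { (inj₁ f∈d) → f∈d ; (inj₂ refl) → e∈ })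
    (∈-insert-old d i δ e)

  insert-delete : e ∈ component d i δ → insert i δ e (delete i δ e d) ≡ d
  insert-delete e∈ = ⊑-antisym below above
    where
    d⁻ = delete i δ e d
    below : insert i δ e d⁻ ⊑ d
    below k γ f∈ = case ∈-insert⁻ d⁻ i δ e k γ f∈ of λ where
      (inj₁ f∈d⁻) → ∈-delete-old d i δ e k γ f∈d⁻
      (inj₂ refl) → e∈
    above : d ⊑ insert i δ e d⁻
    above k γ {f} f∈ with (k , γ , f) ≟ˡ (i , δ , e)
    ... | yes refl = ∈-insert-new d⁻ i δ e
    ... | no ≢     = ∈-insert-old d⁻ i δ e k γ (∈-delete⁺ d i δ e k γ f∈ ≢)

  delete-insert : e ∉ component d i δ → delete i δ e (insert i δ e d) ≡ d
  delete-insert e∉ = ⊑-antisym below above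
    where
    d⁺ = insert i δ e d
    below : delete i δ e d⁺ ⊑ d
    below k γ f∈ = case ∈-insert⁻ d i δ e k γ (∈-delete-old d⁺ i δ e k γ f∈) of λ where
      (inj₁ f∈d)  → f∈d
      (inj₂ refl) → ⊥-elim (∉-delete d⁺ i δ e f∈)
    above : d ⊑ delete i δ e d⁺
    above k γ f∈ = ∈-delete⁺ d⁺ i δ e k γ (∈-insert-old d i δ e k γ f∈) λ { refl → e∉ f∈ }

-- Special decompositions with a covering

-- Disjointness of the two components, phrased with arbitrary superscripts so that it applies to
-- `lookup α i` and its negation without a case split.
SingleValued : Decomposition n m → Set
SingleValued d = ∀ i γ γ′ {e} → e ∈ component d i γ → e ∈ component d i γ′ → γ ≡ γ′

-- The invariant kept along all paths built from insertions: it supplies both premises of `change`.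
record Proper (d : Decomposition n m) (α : Tuple n) : Set where
  field
    singleValued : SingleValued d
    inhabited    : ∀ i → ∃₂ λ γ e → e ∈ component d i γ
    covering     : IsSpecialCovering d α

open Proper

∈-pair : (P : Pair k) → ∀ γ {e} → e ∈ P ⟨ γ ⟩ → e ∈ P ⟨ false ⟩ ∪ P ⟨ true ⟩
∈-pair P false e∈ = x∈p∪q⁺ (inj₁ e∈)
∈-pair P true  e∈ = x∈p∪q⁺ (inj₂ e∈)

proper⇒special : {d : Decomposition n m} {α : Tuple n} → Proper d α → IsSpecialDecomposition d
proper⇒special {d = d} {α} p = record
  { disjoint  = λ i (e , e∈) → let e∈₀ , e∈₁ = x∈p∩q⁻ _ _ e∈ in
                  case singleValued p i false true e∈₀ e∈₁ of λ ()
  ; inhabited = λ i → case inhabited p i of λ where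
                  (false , e∈) → inj₁ e∈
                  (true  , e∈) → inj₂ e∈
  ; covers    = λ e → let i , e∈ = covering p e in i , ∈-pair (lookup d i) (lookup α i) e∈
  }

module _ {d : Decomposition n m} {α : Tuple n} (i : Fin n) (δ : Bool) (e : Fin m) where

  insert-proper : Proper d α → (∀ γ → e ∉ component d i γ) → Proper (insert i δ e d) α
  insert-proper p e∉ = record
    { singleValued = λ k γ γ′ f∈ f∈′ → sv k γ γ′ (∈-insert⁻ d i δ e k γ f∈) (∈-insert⁻ d i δ e k γ′ f∈′)
    ; inhabited    = λ k → let γ , f , f∈ = inhabited p k in γ , f , ∈-insert-old d i δ e k γ f∈
    ; covering     = λ f → let k , f∈ = covering p f in k , ∈-insert-old d i δ e k (lookup α k) f∈
    }
    where
    sv : ∀ k γ γ′ {f} →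
         f ∈ component d k γ ⊎ (k , γ , f) ≡ (i , δ , e) →
         f ∈ component d k γ′ ⊎ (k , γ′ , f) ≡ (i , δ , e) → γ ≡ γ′
    sv k γ γ′ (inj₁ f∈)   (inj₁ f∈′)  = singleValued p k γ γ′ f∈ f∈′
    sv k γ γ′ (inj₁ f∈)   (inj₂ refl) = ⊥-elim (e∉ γ f∈)
    sv k γ γ′ (inj₂ refl) (inj₁ f∈′)  = ⊥-elim (e∉ γ′ f∈′)
    sv k γ γ′ (inj₂ refl) (inj₂ refl) = refl

  -- The covering survives because the deletion takes place outside it, and the second element `f`
  -- keeps pair `i` inhabited.
  delete-proper : Proper d α → δ ≢ lookup α i →
                  ∀ γ {f} → f ∈ component d i γ → f ≢ e → Proper (delete i δ e d) α
  delete-proper p δ≢ γ f∈ f≢e = record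
    { singleValued = λ k γ γ′ g∈ g∈′ →
        singleValued p k γ γ′ (∈-delete-old d i δ e k γ g∈) (∈-delete-old d i δ e k γ′ g∈′)
    ; inhabited    = inh
    ; covering     = λ g → let k , g∈ = covering p g in
                       k , ∈-delete⁺ d i δ e k (lookup α k) g∈ λ { refl → δ≢ refl }
    }
    where
    inh : ∀ k → ∃₂ λ γ g → g ∈ component (delete i δ e d) k γ
    inh k with k ≟ᶠ i
    ... | yes refl = γ , _ , ∈-delete⁺ d i δ e i γ f∈ λ { refl → f≢e refl }
    ... | no k≢i   = let γ , g , g∈ = inhabited p k in
                     γ , g , ∈-delete⁺ d i δ e k γ g∈ λ { refl → k≢i refl }

_⇄_ : State n m → State n m → Set
s ⇄ t = Star ExtendedChange s t × Star ExtendedChange t s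

⇄-refl : {s : State n m} → s ⇄ s
⇄-refl = ε , ε

⇄-sym : {s t : State n m} → s ⇄ t → t ⇄ s
⇄-sym = swap

⇄-trans : {s t u : State n m} → s ⇄ t → t ⇄ u → s ⇄ u
⇄-trans (st , ts) (tu , ut) = st ◅◅ tu , ut ◅◅ ts

insert-⇄ : ∀ {d : Decomposition n m} {α} i δ e → Proper d α → (∀ γ → e ∉ component d i γ) →
           (d , α) ⇄ (insert i δ e d , α)
insert-⇄ {d = d} {α} i δ e p e∉ =
  change (proper⇒special p) (covering p) (add i δ e e∉pair) ◅ ε ,
  change (proper⇒special p⁺) (covering p⁺) undo ◅ ε
  where
  d⁺ = insert i δ e d
  p⁺ : Proper d⁺ α
  p⁺ = insert-proper i δ e p e∉
  e∉pair : e ∉ component d i false ∪ component d i true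
  e∉pair = [ e∉ false , e∉ true ]′ ∘ x∈p∪q⁻ _ _
  undo : AdmissibleChange α d⁺ d
  undo with δ ≟ᵇ lookup α i
  -- Pair `j` covers `e` already in `d`, so the inserting half of the move changes nothing and the
  -- move acts as a bare deletion.
  ... | yes δ≡ = subst (AdmissibleChange α d⁺) eq
                   (move i δ j β e δ≡ refl (∈-insert-new d i δ e)
                     (not-¬ refl ∘ singleValued p⁺ j β (not β) (∈-insert-old d i δ e j β e∈)))
    where
    j = proj₁ (covering p e)
    β = lookup α j
    e∈ = proj₂ (covering p e)
    eq : insert j β e (delete i δ e d⁺) ≡ d
    eq = trans (cong (insert j β e) (delete-insert d i δ e (e∉ δ))) (insert-present d j β e e∈)
  ... | no δ≢ = subst (AdmissibleChange α d⁺) (delete-insert d i δ e (e∉ δ))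
                  (remove i δ e (∈-insert-new d i δ e) δ≢ nonempty-after)
    where
    nonempty-after : Nonempty ((component d⁺ i δ - e) ∪ component d⁺ i (not δ))
    nonempty-after with inhabited p i
    -- The witness is an element of pair `i` from before the insertion; it differs from `e`, which
    -- that pair avoided.
    ... | γ , f , f∈ with γ ≟ᵇ δ
    ...   | yes refl = f , x∈p∪q⁺ (inj₁ (x∈p∧x≢y⇒x∈p-y (∈-insert-old d i δ e i γ f∈)
                                          λ { refl → e∉ γ f∈ }))
    ...   | no γ≢δ   = f , x∈p∪q⁺ (inj₂ (subst (λ γ → f ∈ component d⁺ i γ) (¬-not γ≢δ)
                                          (∈-insert-old d i δ e i γ f∈)))

-- Saturation

-- Only covering components are compared: saturating a pair empties its noncovering component, so
-- `⊑` would fail.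
_≤[_]_ : Decomposition n m → Tuple n → Decomposition n m → Set
d ≤[ α ] d′ = ∀ i → component d i (lookup α i) ⊆ component d′ i (lookup α i)

-- `above` allows goals about covering components to accumulate: what one raise has achieved is
-- preserved by the next.
record Raised (α : Tuple n) (d : Decomposition n m) (Goal : Decomposition n m → Set) : Set where
  field
    raised    : Decomposition n m
    proper    : Proper raised α
    connected : (d , α) ⇄ (raised , α)
    above     : d ≤[ α ] raised
    goal      : Goal raised

open Raised

Covers : Tuple n → Fin n × Fin m → Decomposition n m → Set
Covers α (i , e) d = e ∈ component d i (lookup α i)

raise-empty : ∀ {α : Tuple n} {d : Decomposition n m} i e → Proper d α →
              (∀ γ → e ∉ component d i γ) → Raised α d (Covers α (i , e))
raise-empty {α = α} {d} i e p e∉ = record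
  { raised    = insert i β e d
  ; proper    = insert-proper i β e p e∉
  ; connected = insert-⇄ i β e p e∉
  ; above     = λ k → ∈-insert-old d i β e k (lookup α k)
  ; goal      = ∈-insert-new d i β e
  }
  where β = lookup α i

raise-trans : ∀ {α : Tuple n} {d : Decomposition n m} {P Q : Decomposition n m → Set} →
              (r : Raised α d P) → Raised α (raised r) Q → Raised α d Q
raise-trans r s = record
  { raised    = raised s
  ; proper    = proper s
  ; connected = ⇄-trans (connected r) (connected s)
  ; above     = λ i → above s i ∘ above r i
  ; goal      = goal s
  }

-- The element `e` is deleted from the noncovering component and then inserted into the covering
-- one; `f` keeps the pair nonempty in between.
raise-flip : ∀ {α : Tuple n} {d : Decomposition n m} i e γ {f} → Proper d α →
             e ∈ component d i (not (lookup α i)) → f ∈ component d i γ → f ≢ e →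
             Raised α d (Covers α (i , e))
raise-flip {α = α} {d} i e γ p e∈ f∈ f≢e = record
  { raised    = raised r
  ; proper    = proper r
  ; connected = ⇄-trans (⇄-sym d⁻⇄d) (connected r)
  -- The deleted incidence has the noncovering superscript, so no covering component loses an
  -- element.
  ; above     = λ k g∈ → above r k (∈-delete⁺ d i β e k (lookup α k) g∈ λ c≡ → β≢α (β≡α c≡))
  ; goal      = goal r
  }
  where
  β = not (lookup α i)
  β≢α : β ≢ lookup α i
  β≢α β≡α = not-¬ refl (sym β≡α)
  β≡α : ∀ {k g} → (k , lookup α k , g) ≡ (i , β , e) → β ≡ lookup α i
  β≡α c≡ = trans (sym (cong (proj₁ ∘ proj₂) c≡)) (cong (lookup α ∘ proj₁) c≡)
  d⁻ = delete i β e d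
  p⁻ : Proper d⁻ α
  p⁻ = delete-proper i β e p β≢α γ f∈ f≢e
  e∉ : ∀ γ → e ∉ component d⁻ i γ
  e∉ γ e∈⁻ with refl ← singleValued p i β γ e∈ (∈-delete-old d i β e i γ e∈⁻) =
    ∉-delete d i β e e∈⁻
  -- The deletion is the inverse of an insertion into `d⁻`, hence reversible as well.
  d⁻⇄d : (d⁻ , α) ⇄ (d , α)
  d⁻⇄d = subst (λ d′ → (d⁻ , α) ⇄ (d′ , α)) (insert-delete d i β e e∈) (insert-⇄ i β e p⁻ e∉)
  r : Raised α d⁻ (Covers α (i , e))
  r = raise-empty i e p⁻ e∉

∉-both : ∀ (P : Pair k) {e} β → e ∉ P ⟨ β ⟩ → e ∉ P ⟨ not β ⟩ → ∀ γ → e ∉ P ⟨ γ ⟩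
∉-both P β e∉ e∉′ γ with γ ≟ᵇ β
... | yes refl = e∉
... | no γ≢β with refl ← ¬-not γ≢β = e∉′

-- This is where at least two elements are required.
another : (e : Fin (suc (suc m))) → ∃[ f ] f ≢ e
another zero    = suc zero , λ ()
another (suc _) = zero , λ ()

raise : ∀ {α : Tuple n} {d : Decomposition n (suc (suc m))} → Proper d α →
        ∀ c → Raised α d (Covers α c)
raise {α = α} {d} p (i , e) with e ∈? component d i (lookup α i)
... | yes e∈ = record
  { raised = d ; proper = p ; connected = ⇄-refl ; above = λ i f∈ → f∈ ; goal = e∈ }
... | no e∉ with e ∈? component d i (not (lookup α i))
...   | no e∉′ = raise-empty i e p (∉-both (lookup d i) (lookup α i) e∉ e∉′)
...   | yes e∈ with another e
...     | f , f≢e with f ∈? component d i (lookup α i) | f ∈? component d i (not (lookup α i))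
...       | yes f∈ | _      = raise-flip i e (lookup α i) p e∈ f∈ f≢e
...       | no _   | yes f∈ = raise-flip i e (not (lookup α i)) p e∈ f∈ f≢e
-- Pair `i` avoids `f`, so `f` is first inserted into its covering component and then serves as the
-- second element for the flip.
...       | no f∉  | no f∉′ = raise-trans r
  (raise-flip i e β (proper r) (∈-insert-old d i β f i (not β) e∈) (goal r) f≢e)
  where
  β = lookup α i
  r = raise-empty i f p (∉-both (lookup d i) β f∉ f∉′)

raiseAll : ∀ {α : Tuple n} {d : Decomposition n (suc (suc m))} → Proper d α →
           ∀ cs → Raised α d λ d′ → All (λ c → Covers α c d′) cs
raiseAll {d = d} p [] = record
  { raised = d ; proper = p ; connected = ⇄-refl ; above = λ i e∈ → e∈ ; goal = [] }
raiseAll p ((i , e) ∷ cs) = record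
  { raised    = raised s
  ; proper    = proper s
  ; connected = connected s
  ; above     = above s
  -- The incidence gained for the head of the list persists while the tail is processed.
  ; goal      = above rest i (goal r) ∷ goal s
  }
  where
  r = raise p (i , e)
  rest = raiseAll (proper r) cs
  s = raise-trans r rest

saturated : Bool → Pair k
saturated false = ⊤ , ⊥
saturated true  = ⊥ , ⊤

∈-saturated⁺ : ∀ α {e : Fin k} → e ∈ saturated α ⟨ α ⟩
∈-saturated⁺ false = ∈⊤
∈-saturated⁺ true  = ∈⊤

∈-saturated⁻ : ∀ α γ {e : Fin k} → e ∈ saturated α ⟨ γ ⟩ → γ ≡ α
∈-saturated⁻ false false _  = refl
∈-saturated⁻ false true  e∈ = ⊥-elim (∉⊥ e∈)
∈-saturated⁻ true  false e∈ = ⊥-elim (∉⊥ e∈)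
∈-saturated⁻ true  true  _  = refl

component-saturated : ∀ (α : Tuple n) i γ →
                      component (map (saturated {m}) α) i γ ≡ saturated (lookup α i) ⟨ γ ⟩
component-saturated α i γ = cong (_⟨ γ ⟩) (lookup-map i saturated α)

-- Once every covering component is all of `S`, disjointness forces the other components to be
-- empty.
covers⇒saturated : ∀ {α : Tuple n} {d : Decomposition n m} → SingleValued d →
                   (∀ i e → Covers α (i , e) d) → d ≡ map saturated α
covers⇒saturated {α = α} {d} sv cov = ⊑-antisym below above′
  where
  below : d ⊑ map saturated α
  below i γ {e} e∈ with refl ← sv i γ (lookup α i) e∈ (cov i e) =
    subst (e ∈_) (sym (component-saturated α i γ)) (∈-saturated⁺ (lookup α i))
  above′ : map saturated α ⊑ d
  above′ i γ {e} e∈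
    with refl ← ∈-saturated⁻ (lookup α i) γ (subst (e ∈_) (component-saturated α i γ) e∈) = cov i e

⇄-saturated : ∀ {α : Tuple n} {d : Decomposition n (suc (suc m))} → Proper d α →
              (d , α) ⇄ (map saturated α , α)
⇄-saturated {α = α} {d} p = subst (λ d′ → (d , α) ⇄ (d′ , α)) eq (connected r)
  where
  r = raiseAll p (cartesianProduct (allFin _) (allFin _))
  eq : raised r ≡ map saturated α
  eq = covers⇒saturated (singleValued (proper r)) λ i e →
    All.lookup (goal r) (∈-cartesianProduct⁺ (∈-allFin i) (∈-allFin e))

-- Permutations of components

-- Kept apart from `ExtendedChange` because these steps have no premises about the tuple or the
-- covering, so they can be replayed under another tuple and lifted to longer vectors.
data Permutation : State n m → State n m → Set where
  permute : ∀ {d : Decomposition n m} {α} i →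
            Permutation (d , α) (updateAt d i swap , updateAt α i not)

permutation⇒extended : {s t : State n m} → Permutation s t → ExtendedChange s t
permutation⇒extended (permute i) = permute i

-- Swapping the components of a saturated pair saturates it for the opposite superscript, so it
-- suffices to permute the pairs at which the tuples differ.
permute-saturated : (α β : Tuple n) →
                    Star (Permutation {m = m}) (map saturated α , α) (map saturated β , β)
permute-saturated [] [] = ε
permute-saturated {m = m} (a ∷ α) (b ∷ β) =
  gmap (λ (d , α) → saturated a ∷ d , a ∷ α) (λ { (permute i) → permute (suc i) })
       (permute-saturated α β) ◅◅ first a b
  where
  first : ∀ a b → Star (Permutation {m = m}) (saturated a ∷ map saturated β , a ∷ β)
                                             (saturated b ∷ map saturated β , b ∷ β)
  first false false = ε
  first false true  = permute zero ◅ ε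
  first true  false = permute zero ◅ ε
  first true  true  = ε

-- The effect of a permutation on the decomposition does not depend on the tuple. For `m = 1` this
-- transfers a path starting at the saturating tuple to one starting at the prescribed tuple.
permute-any-tuple : ∀ {d d′ : Decomposition n m} {α α′} → Star Permutation (d , α) (d′ , α′) →
                    ∀ β → ∃[ β′ ] Star Permutation (d , β) (d′ , β′)
permute-any-tuple ε β = β , ε
permute-any-tuple (permute i ◅ steps) β =
  let β′ , steps′ = permute-any-tuple steps (updateAt β i not) in β′ , permute i ◅ steps′

-- An inhabited component is already all of a one-element set, so `β` records which component of
-- each pair is inhabited.
singleton-saturated : {d : Decomposition n 1} {α : Tuple n} → Proper d α →
                      ∃[ β ] d ≡ map saturated β
singleton-saturated {d = d} p = β , covers⇒saturated (singleValued p) cov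
  where
  β = tabulate (proj₁ ∘ inhabited p)
  cov : ∀ i e → Covers β (i , e) d
  cov i zero rewrite lookup∘tabulate (proj₁ ∘ inhabited p) i with inhabited p i
  ... | _ , zero , e∈ = e∈

-- The final tuple is existential because for `m = 1` it is whatever the permutations make of `α`,
-- possibly not `β`.
reachable : ∀ n m .{{_ : NonZero m}} {d d′ : Decomposition n m} {α β} →
            Proper d α → Proper d′ β → ∃[ β′ ] Star ExtendedChange (d , α) (d′ , β′)
reachable n 1 {α = α} p q
  with α₁ , refl ← singleton-saturated p | β₁ , refl ← singleton-saturated q =
  let β′ , steps = permute-any-tuple (permute-saturated α₁ β₁) α
  in β′ , Star.map permutation⇒extended steps
reachable n (suc (suc m)) {α = α} {β} p q =
  β , proj₁ (⇄-saturated p)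
      ◅◅ Star.map permutation⇒extended (permute-saturated α β)
      ◅◅ proj₂ (⇄-saturated q)

-- Decompositions generated by functions

component-transpose : (Ps : Vec (Pair k) l) → ∀ j α →
                      component (transposePairs Ps) j α ≡
                      tabulate λ i → lookup (lookup Ps i ⟨ α ⟩) j
component-transpose Ps j α = trans (cong (_⟨ α ⟩) (lookup∘tabulate _ j)) (at α)
  where
  at : ∀ α → (tabulate (λ i → lookup (lookup Ps i ⟨ false ⟩) j) ,
              tabulate (λ i → lookup (lookup Ps i ⟨ true ⟩) j)) ⟨ α ⟩ ≡
             tabulate λ i → lookup (lookup Ps i ⟨ α ⟩) j
  at false = refl
  at true  = refl

lookup-transpose : (Ps : Vec (Pair k) l) → ∀ j α i →
                   lookup (component (transposePairs Ps) j α) i ≡ lookup (lookup Ps i ⟨ α ⟩) j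
lookup-transpose Ps j α i =
  trans (cong (λ p → lookup p i) (component-transpose Ps j α)) (lookup∘tabulate _ i)

-- Transposition exchanges clause numbers and variable indices in each incidence. Hence the
-- decomposition of a function generates that same function.
transpose-involutive : (Ps : Vec (Pair k) l) → transposePairs (transposePairs Ps) ≡ Ps
transpose-involutive Ps = lookup-injective λ i → cong₂ _,_ (eq i false) (eq i true)
  where
  eq : ∀ i α → component (transposePairs (transposePairs Ps)) i α ≡ lookup Ps i ⟨ α ⟩
  eq i α = lookup-injective λ j →
    trans (lookup-transpose (transposePairs Ps) i α j) (lookup-transpose Ps j α i)

module _ (f : CNF n m) where

  ∈-decompositionOf⁺ : ∀ i α {j} → i ∈ lookup (clauses f) j ⟨ α ⟩ →
                       j ∈ component (decompositionOf f) i α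
  ∈-decompositionOf⁺ i α {j} i∈ =
    lookup⇒[]= j _ (trans (lookup-transpose (clauses f) i α j) ([]=⇒lookup i∈))

  ∈-decompositionOf⁻ : ∀ i α {j} → j ∈ component (decompositionOf f) i α →
                       i ∈ lookup (clauses f) j ⟨ α ⟩
  ∈-decompositionOf⁻ i α {j} j∈ =
    lookup⇒[]= i _ (trans (sym (lookup-transpose (clauses f) i α j)) ([]=⇒lookup j∈))

evalLiteral⇒≡ : ∀ (σ : Tuple n) i α → T (evalLiteral σ i α) → α ≡ lookup σ i
evalLiteral⇒≡ σ i false t with false ← lookup σ i = refl
evalLiteral⇒≡ σ i true  t with true  ← lookup σ i = refl

-- A true clause contains a true literal, and the superscript of a true literal is the value that
-- `σ` gives to its variable.
evalClause⇒∈ : ∀ (c : Clause n) σ → T (evalClause c σ) → ∃[ i ] i ∈ c ⟨ lookup σ i ⟩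
evalClause⇒∈ {n} c σ t with i , ti ← satisfied (any⁻ _ (allFin n) t) =
  i , [ literal false , literal true ]′ (Equivalence.to T-∨ ti)
  where
  literal : ∀ α → T (lookup (c ⟨ α ⟩) i ∧ evalLiteral σ i α) → i ∈ c ⟨ lookup σ i ⟩
  literal α tα with t∈ , tσ ← Equivalence.to T-∧ tα
    with refl ← evalLiteral⇒≡ σ i α tσ = lookup⇒[]= i _ (Equivalence.to T-≡ t∈)

-- The conditions correspond one by one: consistency of clauses to disjointness, occurrence of
-- variables to inhabited pairs, satisfaction by `σ` to the covering.
decompositionOf-proper : (f : CNF n m) (σ : Tuple n) → eval f σ ≡ true →
                         Proper (decompositionOf f) σ
decompositionOf-proper {m = m} f σ fσ = record
  { singleValued = λ i γ γ′ e∈ e∈′ →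
                     sv γ γ′ (∈-decompositionOf⁻ f i γ e∈) (∈-decompositionOf⁻ f i γ′ e∈′)
  ; inhabited    = λ i → let j , α , i∈ = occurs f i in α , j , ∈-decompositionOf⁺ f i α i∈
  ; covering     = λ j →
      let i , i∈ = evalClause⇒∈ (lookup (clauses f) j) σ
                     (All.lookup (all⁺ _ (allFin m) (Equivalence.from T-≡ fσ)) (∈-allFin j))
      in i , ∈-decompositionOf⁺ f i (lookup σ i) i∈
  }
  where
  sv : ∀ {i j} γ γ′ → i ∈ lookup (clauses f) j ⟨ γ ⟩ → i ∈ lookup (clauses f) j ⟨ γ′ ⟩ → γ ≡ γ′
  sv false false _  _   = refl
  sv false true  i∈ i∈′ = ⊥-elim (consistent f _ _ (i∈ , i∈′))
  sv true  false i∈ i∈′ = ⊥-elim (consistent f _ _ (i∈′ , i∈))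
  sv true  true  _  _   = refl

-- The target of the path is the decomposition of `h` itself; satisfiability of `h` enters by making
-- that decomposition proper under `δ`.
generated : .{{_ : NonZero m}} (f h : CNF n m) (σ δ : Tuple n) →
            eval f σ ≡ true → eval h δ ≡ true → GeneratedFrom f σ h
generated f h σ δ fσ hδ = record
  { startCovering = covering p
  ; final         = decompositionOf h
  ; finalTuple    = proj₁ path
  ; changes       = proj₂ path
  ; finalSpecial  = proper⇒special q
  ; generates     = sym (transpose-involutive (clauses h))
  }
  where
  p = decompositionOf-proper f σ fσ
  q = decompositionOf-proper h δ hδ
  path = reachable _ _ p q

theorem6p6 : (n m : ℕ) .{{_ : NonZero n}} .{{_ : NonZero m}}
    (f h : CNF n m) (σ δ : Tuple n) →
    eval f σ ≡ true → eval h δ ≡ true →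
    GeneratedFrom f σ h × GeneratedFrom h δ f
theorem6p6 n m f h σ δ fσ hδ = generated f h σ δ fσ hδ , generated h f δ σ hδ fσ
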